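{- (Derivability of the translated interaction axioms of (I)EAK.) For every atomic proposition $p$, every functional action $\alpha$ of type $\mathsf{Fnc}$, every agent $\mathtt a$ of type $\mathsf{Ag}$ and all operational terms $A,B$ of type $\mathsf{Fm}$, the following sequents are derivable in the Dynamic Calculus defined in the context (without the Grishin rules), where $C\dashv\vdash D$ means that both $C\vdash D$ and $D\vdash C$ are derivable: 1. $\alpha\vartriangle_0 p\dashv\vdash(\alpha\vartriangle_0\top)\wedge p$; 2. $\alpha\vartriangleright_0 p\dashv\vdash(\alpha\vartriangle_0\top)\to p$; 3. $\alpha\vartriangle_0\bot\dashv\vdash\bot$; 4. $\alpha\vartriangle_0\top\dashv\vdash\alpha\vartriangle_0\top$; 5. $\alpha\vartriangleright_0\top\dashv\vdash\top$; 6. $\alpha\vartriangleright_0\bot\dashv\vdash(\alpha\vartriangle_0\top)\to\bot$; 7. $\alpha\vartriangleright_0(A\wedge B)\dashv\vdash(\alpha\vartriangleright_0A)\wedge(\alpha\vartriangleright_0B)$; 8. $\alpha\vartriangle_0(A\wedge B)\dashv\vdash(\alpha\vartriangle_0A)\wedge(\alpha\vartriangle_0B)$; 9. $\alpha\vartriangle_0(A\vee B)\dashv\vdash(\alpha\vartriangle_0A)\vee(\alpha\vartriangle_0B)$; 10. $\alpha\vartriangleright_0(A\vee B)\dashv\vdash(\alpha\vartriangle_0\top)\to((\alpha\vartriangle_0A)\vee(\alpha\vartriangle_0B))$; 11. $\alpha\vartriangle_0(A\to B)\dashv\vdash(\alpha\vartriangle_0\top)\wedge((\alpha\vartriangle_0A)\to(\alpha\vartriangle_0B))$;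 12. $\alpha\vartriangleright_0(A\to B)\dashv\vdash(\alpha\vartriangle_0A)\to(\alpha\vartriangle_0B)$; 13. $\alpha\vartriangle_0(\mathtt a\vartriangle_2A)\dashv\vdash(\alpha\vartriangle_0\top)\wedge(\mathtt a\vartriangle_2((\mathtt a\blacktriangle_3\alpha)\vartriangle_1A))$; 14. $\alpha\vartriangleright_0(\mathtt a\vartriangle_2A)\dashv\vdash(\alpha\vartriangle_0\top)\to(\mathtt a\vartriangle_2((\mathtt a\blacktriangle_3\alpha)\vartriangle_1A))$; 15. $\alpha\vartriangleright_0(\mathtt a\vartriangleright_2A)\dashv\vdash(\alpha\vartriangle_0\top)\to(\mathtt a\vartriangleright_2((\mathtt a\blacktriangle_3\alpha)\vartriangleright_1A))$; 16. $\alpha\vartriangle_0(\mathtt a\vartriangleright_2A)\dashv\vdash(\alpha\vartriangle_0\top)\wedge(\mathtt a\vartriangleright_2((\mathtt a\blacktriangle_3\alpha)\vartriangleright_1A))$.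
   Context: These sequents are the translations of the interaction axioms of the intuitionistic logic of epistemic actions and knowledge, under $\langle\alpha\rangle A\mapsto\alpha\vartriangle_0A$, $[\alpha]A\mapsto\alpha\vartriangleright_0A$, $\langle\mathtt a\rangle A\mapsto\mathtt a\vartriangle_2A$, $[\mathtt a]A\mapsto\mathtt a\vartriangleright_2A$, $Pre(\alpha)\mapsto\alpha\vartriangle_0\top$, $\bigvee\{\langle\mathtt a\rangle\langle\beta\rangle A\mid\alpha\mathtt a\beta\}\mapsto\mathtt a\vartriangle_2((\mathtt a\blacktriangle_3\alpha)\vartriangle_1A)$ and $\bigwedge\{[\mathtt a][\beta]A\mid\alpha\mathtt a\beta\}\mapsto\mathtt a\vartriangleright_2((\mathtt a\blacktriangle_3\alpha)\vartriangleright_1A)$. **The Dynamic Calculus.** Notation: an inference is written "premises / conclusion"; "//" marks a rule applicable in both directions. Hatted symbols are structural connectives, unhatted ones operational connectives, and symbols with a tilde are structural connectives called virtual adjoints. *Operational terms.* There are four pairwise disjoint types $\mathsf{Fm},\mathsf{Fnc},\mathsf{Act},\mathsf{Ag}$. Given sets of atomic propositions $p$, of atomic functional actions $\alpha$ and of atomic agents $\mathtt a$: the terms of type $\mathsf{Fnc}$ are the atoms $\alpha$; the terms of type $\mathsf{Ag}$ are the atoms $\mathtt a$; the terms of type $\mathsf{Act}$ are $\gamma ::= \mathtt a\blacktriangle_3\alpha\mid \mathtt a\vartriangle_3\alpha$; the terms of type $\mathsf{Fm}$ are $A::= p\mid\bot\mid\top\mid A\wedge A\mid A\vee A\mid A\to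 A\mid A\leftarrow A\mid A\succ A\mid A\prec A\mid \alpha\,\sharp_0 A\mid\gamma\,\sharp_1 A\mid\mathtt a\,\sharp_2 A$, where $\sharp\in\{\vartriangle,\blacktriangle,\vartriangleright,\blacktriangleright\}$. *Structures.* The types $\mathsf{FM}\ni X$, $\mathsf{FNC}\ni F$, $\mathsf{ACT}\ni\Gamma$, $\mathsf{AG}\ni\mathbf a$ are defined by simultaneous recursion: $X::=A\mid \mathrm I\mid X;X\mid X>X\mid X<X\mid F\,\hat\sharp_0 X\mid\Gamma\,\hat\sharp_1X\mid\mathbf a\,\hat\sharp_2X$ with $\hat\sharp\in\{\hat\vartriangle,\hat\blacktriangle,\hat\vartriangleright,\hat\blacktriangleright\}$; $F::=\alpha\mid X\tilde\vartriangleleft_0X\mid X\tilde\blacktriangleleft_0X\mid\mathbf a\,\tilde\vartriangleright_3\Gamma\mid\mathbf a\,\tilde\blacktriangleright_3\Gamma$; $\Gamma::=\gamma\mid\mathbf a\,\hat\blacktriangle_3F\mid\mathbf a\,\hat\vartriangle_3F\mid X\hat\vartriangleleft_1X\mid X\hat\blacktriangleleft_1X$; $\mathbf a::=\mathtt a\mid X\tilde\vartriangleleft_2X\mid X\tilde\blacktriangleleft_2X\mid\Gamma\tilde\vartriangleleft_3F\mid\Gamma\tilde\blacktriangleleft_3F$. Sequents have the form $x\vdash y$ with $x,y$ structures. Below $X,Y,Z,W$ are of type $\mathsf{FM}$; $A,B$ of type $\mathsf{Fm}$; $x,y,z$ are structures and $a,b$ operational terms of the type making the expression well formed. *Axioms.*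 $\mathtt a\vdash\mathtt a$; $\alpha\vdash\alpha$; $\bot\vdash\mathrm I$; $\mathrm I\vdash\top$; and *atom*: $F_1\circ_1(F_2\circ_2\cdots(F_n\circ_n p)\cdots)\vdash G_1\rhd_1(G_2\rhd_2\cdots(G_m\rhd_m p)\cdots)$ for $n,m\ge0$, $F_i,G_j\in\mathsf{FNC}$, $\circ_i\in\{\hat\vartriangle_0,\hat\blacktriangle_0\}$, $\rhd_j\in\{\hat\vartriangleright_0,\hat\blacktriangleright_0\}$ (in particular $p\vdash p$). *Cut rules* (one per type): $x\vdash a,\ a\vdash y\ /\ x\vdash y$, with $x,a,y$ all of the same type (agents, functional actions, actions, or formulas). *Propositional structural rules.* $X\vdash Y\ //\ \mathrm I\vdash Y<X$; $X\vdash Y\ //\ X<Y\vdash\mathrm I$; $X\vdash Y\ //\ \mathrm I\vdash X>Y$; $X\vdash Y\ //\ Y>X\vdash\mathrm I$; $\mathrm I\vdash X\ /\ Y\vdash X$; $X\vdash\mathrm I\ /\ X\vdash Y$; $X\vdash Z\ /\ Y\vdash Z<X$; $X\vdash Z\ /\ X<Z\vdash Y$; $X\vdash Z\ /\ Y\vdash X>Z$; $X\vdash Z\ /\ Z>X\vdash Y$; $X;X\vdash Y\ /\ X\vdash Y$; $Y\vdash X;X\ /\ Y\vdash X$; $Y;X\vdash Z\ /\ X;Y\vdash Z$; $Z\vdash X;Y\ /\ Z\vdash Y;X$; $X;(Y;Z)\vdash W\ /\ (X;Y);Z\vdash W$; $W\vdash(Z;Y);X\ /\ W\vdash Z;(Y;X)$.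 Display postulates: $X;Y\vdash Z\ //\ X\vdash Z<Y$; $Z\vdash X;Y\ //\ Z<Y\vdash X$; $X;Y\vdash Z\ //\ Y\vdash X>Z$; $Z\vdash X;Y\ //\ X>Z\vdash Y$. (The Grishin rules $X>(Y;Z)\vdash W\ //\ (X>Y);Z\vdash W$ and $W\vdash X>(Y;Z)\ //\ W\vdash(X>Y);Z$ give the classical base and are not included here.) *Propositional operational rules.* $X\vdash\mathrm I\ /\ X\vdash\bot$; $\mathrm I\vdash X\ /\ \top\vdash X$; $A;B\vdash Z\ /\ A\wedge B\vdash Z$; $X\vdash A,\ Y\vdash B\ /\ X;Y\vdash A\wedge B$; $A\vdash X,\ B\vdash Y\ /\ A\vee B\vdash X;Y$; $Z\vdash A;B\ /\ Z\vdash A\vee B$; $B\vdash Y,\ X\vdash A\ /\ B\leftarrow A\vdash Y<X$; $Z\vdash B<A\ /\ Z\vdash B\leftarrow A$; $B<A\vdash Z\ /\ B\prec A\vdash Z$; $Y\vdash B,\ A\vdash X\ /\ Y<X\vdash B\prec A$; $X\vdash A,\ B\vdash Y\ /\ A\to B\vdash X>Y$; $Z\vdash A>B\ /\ Z\vdash A\to B$; $A>B\vdash Z\ /\ A\succ B\vdash Z$; $A\vdash X,\ Y\vdash B\ /\ X>Y\vdash A\succ B$. *Heterogeneous operational rules.* For $0\le i\le3$ and $\sharp\in\{\vartriangle,\blacktriangle\}$: $a\,\hat\sharp_i\,b\vdash z\ /\ a\,\sharp_i\,b\vdash z$; $x\vdash a,\ y\vdash b\ /\ x\,\hat\sharp_i\,y\vdash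 a\,\sharp_i\,b$. For $0\le i\le2$ and $\sharp\in\{\vartriangleright,\blacktriangleright\}$: $x\vdash a,\ B\vdash Y\ /\ a\,\sharp_iB\vdash x\,\hat\sharp_iY$; $Z\vdash a\,\hat\sharp_iB\ /\ Z\vdash a\,\sharp_iB$. *Heterogeneous display postulates.* For $0\le i\le2$: $x\hat\vartriangle_iy\vdash z\ //\ y\vdash x\hat\blacktriangleright_iz$; $x\hat\blacktriangle_iy\vdash z\ //\ y\vdash x\hat\vartriangleright_iz$. For $i=1$: $x\hat\vartriangle_1y\vdash z\ //\ x\vdash z\hat\blacktriangleleft_1y$; $x\hat\blacktriangle_1y\vdash z\ //\ x\vdash z\hat\vartriangleleft_1y$. For $i\in\{0,2,3\}$: $x\hat\vartriangle_iy\vdash z\ //\ x\vdash z\tilde\blacktriangleleft_iy$; $x\hat\blacktriangle_iy\vdash z\ //\ x\vdash z\tilde\vartriangleleft_iy$. For $i=3$: $x\hat\vartriangle_3y\vdash z\ //\ y\vdash x\tilde\blacktriangleright_3z$; $x\hat\blacktriangle_3y\vdash z\ //\ y\vdash x\tilde\vartriangleright_3z$. *Necessitation, conjugation, Fischer Servi, monotonicity*, for $0\le i\le2$: $\mathrm I\vdash W\ /\ x\hat\vartriangle_i\mathrm I\vdash W$; $\mathrm I\vdash W\ /\ x\hat\blacktriangle_i\mathrm I\vdash W$; $W\vdash\mathrm I\ /\ W\vdash x\hat\vartriangleright_i\mathrm I$; $W\vdash\mathrm I\ /\ W\vdash x\hat\blacktriangleright_i\mathrm I$; $x\hat\vartriangle_i((x\hat\blacktriangle_iY);Z)\vdash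 W\ /\ Y;(x\hat\vartriangle_iZ)\vdash W$; $x\hat\blacktriangle_i((x\hat\vartriangle_iY);Z)\vdash W\ /\ Y;(x\hat\blacktriangle_iZ)\vdash W$; $W\vdash x\hat\vartriangleright_i((x\hat\blacktriangleright_iY);Z)\ /\ W\vdash Y;(x\hat\vartriangleright_iZ)$; $W\vdash x\hat\blacktriangleright_i((x\hat\vartriangleright_iY);Z)\ /\ W\vdash Y;(x\hat\blacktriangleright_iZ)$; $(x\hat\vartriangleright_iY)>(x\hat\vartriangle_iZ)\vdash W\ /\ x\hat\vartriangle_i(Y>Z)\vdash W$; $(x\hat\blacktriangleright_iY)>(x\hat\blacktriangle_iZ)\vdash W\ /\ x\hat\blacktriangle_i(Y>Z)\vdash W$; $W\vdash(x\hat\vartriangle_iY)>(x\hat\vartriangleright_iZ)\ /\ W\vdash x\hat\vartriangleright_i(Y>Z)$; $W\vdash(x\hat\blacktriangle_iY)>(x\hat\blacktriangleright_iZ)\ /\ W\vdash x\hat\blacktriangleright_i(Y>Z)$; $(x\hat\vartriangle_iY);(x\hat\vartriangle_iZ)\vdash W\ /\ x\hat\vartriangle_i(Y;Z)\vdash W$; $(x\hat\blacktriangle_iY);(x\hat\blacktriangle_iZ)\vdash W\ /\ x\hat\blacktriangle_i(Y;Z)\vdash W$; $W\vdash(x\hat\vartriangleright_iY);(x\hat\vartriangleright_iZ)\ /\ W\vdash x\hat\vartriangleright_i(Y;Z)$; $W\vdash(x\hat\blacktriangleright_iY);(x\hat\blacktriangleright_iZ)\ /\ W\vdash x\hat\blacktriangleright_i(Y;Z)$.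 *Interaction rules.* swap-out: $(\mathbf a\hat\blacktriangle_3F)\hat\blacktriangle_1(\mathbf a\hat\blacktriangle_2X)\vdash Y\ /\ \mathbf a\hat\blacktriangle_2(F\hat\blacktriangle_0X)\vdash Y$; $X\vdash(\mathbf a\hat\blacktriangle_3F)\hat\blacktriangleright_1(\mathbf a\hat\blacktriangleright_2Y)\ /\ X\vdash\mathbf a\hat\blacktriangleright_2(F\hat\blacktriangleright_0Y)$. swap-in: $\mathbf a\hat\blacktriangle_2(F\hat\blacktriangle_0X)\vdash Y\ /\ (\mathbf a\hat\blacktriangle_3F)\hat\blacktriangle_1(\mathbf a\hat\blacktriangle_2((F\hat\vartriangle_0\mathrm I);X))\vdash Y$; $X\vdash\mathbf a\hat\blacktriangleright_2(F\hat\blacktriangleright_0Y)\ /\ X\vdash(\mathbf a\hat\blacktriangle_3F)\hat\blacktriangleright_1(\mathbf a\hat\blacktriangleright_2((F\hat\vartriangle_0\mathrm I)>Y))$. balance: $X\vdash Y\ /\ F\hat\vartriangle_0X\vdash F\hat\vartriangleright_0Y$, for $F\in\mathsf{FNC}$. -}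

module Defs where

open import Level using (Level; _⊔_)
open import Data.Product using (_×_)

-- The types Fnc, Act, Ag are represented as act i₀, act i₁, act i₂: the index i of a
-- heterogeneous connective ♯ᵢ (0 ≤ i ≤ 2) is determined by the type of its first argument.
data Idx : Set where
  i₀ i₁ i₂ : Idx

data Ty : Set where
  FM  : Ty
  act : Idx → Ty

pattern FNC = act i₀
pattern ACT = act i₁
pattern AG  = act i₂

module DynamicCalculus {ℓp ℓf ℓa : Level}
  (AtProp : Set ℓp) (AtFnc : Set ℓf) (AtAg : Set ℓa) where

  infix  10 _△₃_ _▲₃_ _△₃ˢ_ _▲₃ˢ_ _▷₃ˢ_ _▶₃ˢ_ _◁₃ˢ_ _◀₃ˢ_
  infixr  9 _△_ _▲_ _▷_ _▶_ _△₀_ _▷₀_ _△₁_ _▷₁_ _△₂_ _▷₂_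
  infixr  9 _△ˢ_ _▲ˢ_ _▷ˢ_ _▶ˢ_
  infix   9 _◁ˢ_ _◀ˢ_
  infix   8 _∧_ _∨_
  infix   7 _⟶_ _⟵_ _≻_ _≺_
  infix   6 _⨾_ _>_ _<_
  infix   4 _⊢_ _⊣⊢_

  data Tm : Ty → Set (ℓp ⊔ ℓf ⊔ ℓa) where
    prop            : AtProp → Tm FM
    fnc             : AtFnc → Tm FNC
    agent           : AtAg → Tm AG
    _▲₃_ _△₃_       : Tm AG → Tm FNC → Tm ACT
    ⊥ ⊤             : Tm FM
    _∧_ _∨_         : Tm FM → Tm FM → Tm FM
    _⟶_ _⟵_         : Tm FM → Tm FM → Tm FM
    _≻_ _≺_         : Tm FM → Tm FM → Tm FM
    _△_ _▲_ _▷_ _▶_ : ∀ {i} → Tm (act i) → Tm FM → Tm FM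

  pattern _△₀_ α A = _△_ {i = i₀} α A
  pattern _▷₀_ α A = _▷_ {i = i₀} α A
  pattern _△₁_ γ A = _△_ {i = i₁} γ A
  pattern _▷₁_ γ A = _▷_ {i = i₁} γ A
  pattern _△₂_ a A = _△_ {i = i₂} a A
  pattern _▷₂_ a A = _▷_ {i = i₂} a A

  -- The superscript ˢ marks structural connectives.  It stands both for the hat and for
  -- the tilde of the virtual adjoints (◁ˢ, ◀ˢ at i = 0, 2 and ▷₃ˢ, ▶₃ˢ, ◁₃ˢ, ◀₃ˢ); a
  -- connective never carries both decorations at the same index.
  data Str : Ty → Set (ℓp ⊔ ℓf ⊔ ℓa) where
    ⌜_⌝                 : ∀ {t} → Tm t → Str t
    I                   : Str FM
    _⨾_ _>_ _<_         : Str FM → Str FM → Str FM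
    _△ˢ_ _▲ˢ_ _▷ˢ_ _▶ˢ_ : ∀ {i} → Str (act i) → Str FM → Str FM
    _◁ˢ_ _◀ˢ_           : ∀ {i} → Str FM → Str FM → Str (act i)
    _△₃ˢ_ _▲₃ˢ_         : Str AG → Str FNC → Str ACT
    _▷₃ˢ_ _▶₃ˢ_         : Str AG → Str ACT → Str FNC
    _◁₃ˢ_ _◀₃ˢ_         : Str ACT → Str FNC → Str AG

  -- Antecedents F₁ ∘₁ (⋯ (Fₙ ∘ₙ p)) and succedents G₁ ▹₁ (⋯ (Gₘ ▹ₘ p)) of the atom axiom.
  data AtomL (p : AtProp) : Str FM → Set (ℓp ⊔ ℓf ⊔ ℓa) where
    here : AtomL p ⌜ prop p ⌝
    △-at : ∀ {X} (F : Str FNC) → AtomL p X → AtomL p (F △ˢ X)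
    ▲-at : ∀ {X} (F : Str FNC) → AtomL p X → AtomL p (F ▲ˢ X)

  data AtomR (p : AtProp) : Str FM → Set (ℓp ⊔ ℓf ⊔ ℓa) where
    here : AtomR p ⌜ prop p ⌝
    ▷-at : ∀ {X} (F : Str FNC) → AtomR p X → AtomR p (F ▷ˢ X)
    ▶-at : ∀ {X} (F : Str FNC) → AtomR p X → AtomR p (F ▶ˢ X)

  private variable
    i               : Idx
    t               : Ty
    X Y Z W         : Str FM
    A B             : Tm FM
    x y z           : Str t
    a b             : Tm t
    𝐚               : Str AG
    F               : Str FNC
    Γ               : Str ACT

  -- x ⊢ y is the type of derivations of the sequent.  A rule invertible in the paper
  -- (double line) is a pair of constructors, the second marked ⁻¹.  The Grishin rules are
  -- not included, so the propositional base is intuitionistic.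
  data _⊢_ : ∀ {t} → Str t → Str t → Set (ℓp ⊔ ℓf ⊔ ℓa) where

    ax-ag  : (c : AtAg) → ⌜ agent c ⌝ ⊢ ⌜ agent c ⌝
    ax-fnc : (c : AtFnc) → ⌜ fnc c ⌝ ⊢ ⌜ fnc c ⌝
    ax-⊥   : ⌜ ⊥ ⌝ ⊢ I
    ax-⊤   : I ⊢ ⌜ ⊤ ⌝
    atom   : ∀ {p} → AtomL p X → AtomR p Y → X ⊢ Y
    cut    : ∀ {t} {x y : Str t} (a : Tm t) → x ⊢ ⌜ a ⌝ → ⌜ a ⌝ ⊢ y → x ⊢ y

    I<ʳ   : X ⊢ Y → I ⊢ Y < X
    I<ʳ⁻¹ : I ⊢ Y < X → X ⊢ Y
    I<ˡ   : X ⊢ Y → X < Y ⊢ I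
    I<ˡ⁻¹ : X < Y ⊢ I → X ⊢ Y
    I>ʳ   : X ⊢ Y → I ⊢ X > Y
    I>ʳ⁻¹ : I ⊢ X > Y → X ⊢ Y
    I>ˡ   : X ⊢ Y → Y > X ⊢ I
    I>ˡ⁻¹ : Y > X ⊢ I → X ⊢ Y
    IWˡ   : I ⊢ X → Y ⊢ X
    IWʳ   : X ⊢ I → X ⊢ Y
    W<ʳ   : X ⊢ Z → Y ⊢ Z < X
    W<ˡ   : X ⊢ Z → X < Z ⊢ Y
    W>ʳ   : X ⊢ Z → Y ⊢ X > Z
    W>ˡ   : X ⊢ Z → Z > X ⊢ Y
    Cˡ    : X ⨾ X ⊢ Y → X ⊢ Y
    Cʳ    : Y ⊢ X ⨾ X → Y ⊢ X
    Eˡ    : Y ⨾ X ⊢ Z → X ⨾ Y ⊢ Z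
    Eʳ    : Z ⊢ X ⨾ Y → Z ⊢ Y ⨾ X
    Aˡ    : X ⨾ (Y ⨾ Z) ⊢ W → (X ⨾ Y) ⨾ Z ⊢ W
    Aʳ    : W ⊢ (Z ⨾ Y) ⨾ X → W ⊢ Z ⨾ (Y ⨾ X)

    ⨾<   : X ⨾ Y ⊢ Z → X ⊢ Z < Y
    ⨾<⁻¹ : X ⊢ Z < Y → X ⨾ Y ⊢ Z
    <⨾   : Z ⊢ X ⨾ Y → Z < Y ⊢ X
    <⨾⁻¹ : Z < Y ⊢ X → Z ⊢ X ⨾ Y
    ⨾>   : X ⨾ Y ⊢ Z → Y ⊢ X > Z
    ⨾>⁻¹ : Y ⊢ X > Z → X ⨾ Y ⊢ Z
    >⨾   : Z ⊢ X ⨾ Y → X > Z ⊢ Y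
    >⨾⁻¹ : X > Z ⊢ Y → Z ⊢ X ⨾ Y

    ⊥ʳ : X ⊢ I → X ⊢ ⌜ ⊥ ⌝
    ⊤ˡ : I ⊢ X → ⌜ ⊤ ⌝ ⊢ X
    ∧ˡ : ⌜ A ⌝ ⨾ ⌜ B ⌝ ⊢ Z → ⌜ A ∧ B ⌝ ⊢ Z
    ∧ʳ : X ⊢ ⌜ A ⌝ → Y ⊢ ⌜ B ⌝ → X ⨾ Y ⊢ ⌜ A ∧ B ⌝
    ∨ˡ : ⌜ A ⌝ ⊢ X → ⌜ B ⌝ ⊢ Y → ⌜ A ∨ B ⌝ ⊢ X ⨾ Y
    ∨ʳ : Z ⊢ ⌜ A ⌝ ⨾ ⌜ B ⌝ → Z ⊢ ⌜ A ∨ B ⌝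
    ⟵ˡ : ⌜ B ⌝ ⊢ Y → X ⊢ ⌜ A ⌝ → ⌜ B ⟵ A ⌝ ⊢ Y < X
    ⟵ʳ : Z ⊢ ⌜ B ⌝ < ⌜ A ⌝ → Z ⊢ ⌜ B ⟵ A ⌝
    ≺ˡ : ⌜ B ⌝ < ⌜ A ⌝ ⊢ Z → ⌜ B ≺ A ⌝ ⊢ Z
    ≺ʳ : Y ⊢ ⌜ B ⌝ → ⌜ A ⌝ ⊢ X → Y < X ⊢ ⌜ B ≺ A ⌝
    ⟶ˡ : X ⊢ ⌜ A ⌝ → ⌜ B ⌝ ⊢ Y → ⌜ A ⟶ B ⌝ ⊢ X > Y
    ⟶ʳ : Z ⊢ ⌜ A ⌝ > ⌜ B ⌝ → Z ⊢ ⌜ A ⟶ B ⌝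
    ≻ˡ : ⌜ A ⌝ > ⌜ B ⌝ ⊢ Z → ⌜ A ≻ B ⌝ ⊢ Z
    ≻ʳ : ⌜ A ⌝ ⊢ X → Y ⊢ ⌜ B ⌝ → X > Y ⊢ ⌜ A ≻ B ⌝

    △ˡ  : ⌜ a ⌝ △ˢ ⌜ B ⌝ ⊢ Z → ⌜ a △ B ⌝ ⊢ Z
    △ʳ  : x ⊢ ⌜ a ⌝ → Y ⊢ ⌜ B ⌝ → x △ˢ Y ⊢ ⌜ a △ B ⌝
    ▲ˡ  : ⌜ a ⌝ ▲ˢ ⌜ B ⌝ ⊢ Z → ⌜ a ▲ B ⌝ ⊢ Z
    ▲ʳ  : x ⊢ ⌜ a ⌝ → Y ⊢ ⌜ B ⌝ → x ▲ˢ Y ⊢ ⌜ a ▲ B ⌝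
    △₃ˡ : ⌜ a ⌝ △₃ˢ ⌜ b ⌝ ⊢ z → ⌜ a △₃ b ⌝ ⊢ z
    △₃ʳ : x ⊢ ⌜ a ⌝ → y ⊢ ⌜ b ⌝ → x △₃ˢ y ⊢ ⌜ a △₃ b ⌝
    ▲₃ˡ : ⌜ a ⌝ ▲₃ˢ ⌜ b ⌝ ⊢ z → ⌜ a ▲₃ b ⌝ ⊢ z
    ▲₃ʳ : x ⊢ ⌜ a ⌝ → y ⊢ ⌜ b ⌝ → x ▲₃ˢ y ⊢ ⌜ a ▲₃ b ⌝
    ▷ˡ  : x ⊢ ⌜ a ⌝ → ⌜ B ⌝ ⊢ Y → ⌜ a ▷ B ⌝ ⊢ x ▷ˢ Y
    ▷ʳ  : Z ⊢ ⌜ a ⌝ ▷ˢ ⌜ B ⌝ → Z ⊢ ⌜ a ▷ B ⌝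
    ▶ˡ  : x ⊢ ⌜ a ⌝ → ⌜ B ⌝ ⊢ Y → ⌜ a ▶ B ⌝ ⊢ x ▶ˢ Y
    ▶ʳ  : Z ⊢ ⌜ a ⌝ ▶ˢ ⌜ B ⌝ → Z ⊢ ⌜ a ▶ B ⌝

    △▶    : x △ˢ Y ⊢ Z → Y ⊢ x ▶ˢ Z
    △▶⁻¹  : Y ⊢ x ▶ˢ Z → x △ˢ Y ⊢ Z
    ▲▷    : x ▲ˢ Y ⊢ Z → Y ⊢ x ▷ˢ Z
    ▲▷⁻¹  : Y ⊢ x ▷ˢ Z → x ▲ˢ Y ⊢ Z
    △◀    : x △ˢ Y ⊢ Z → x ⊢ Z ◀ˢ Y
    △◀⁻¹  : x ⊢ Z ◀ˢ Y → x △ˢ Y ⊢ Z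
    ▲◁    : x ▲ˢ Y ⊢ Z → x ⊢ Z ◁ˢ Y
    ▲◁⁻¹  : x ⊢ Z ◁ˢ Y → x ▲ˢ Y ⊢ Z
    △▶₃   : 𝐚 △₃ˢ F ⊢ Γ → F ⊢ 𝐚 ▶₃ˢ Γ
    △▶₃⁻¹ : F ⊢ 𝐚 ▶₃ˢ Γ → 𝐚 △₃ˢ F ⊢ Γ
    ▲▷₃   : 𝐚 ▲₃ˢ F ⊢ Γ → F ⊢ 𝐚 ▷₃ˢ Γ
    ▲▷₃⁻¹ : F ⊢ 𝐚 ▷₃ˢ Γ → 𝐚 ▲₃ˢ F ⊢ Γ
    △◀₃   : 𝐚 △₃ˢ F ⊢ Γ → 𝐚 ⊢ Γ ◀₃ˢ F
    △◀₃⁻¹ : 𝐚 ⊢ Γ ◀₃ˢ F → 𝐚 △₃ˢ F ⊢ Γ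
    ▲◁₃   : 𝐚 ▲₃ˢ F ⊢ Γ → 𝐚 ⊢ Γ ◁₃ˢ F
    ▲◁₃⁻¹ : 𝐚 ⊢ Γ ◁₃ˢ F → 𝐚 ▲₃ˢ F ⊢ Γ

    nec△ : I ⊢ W → x △ˢ I ⊢ W
    nec▲ : I ⊢ W → x ▲ˢ I ⊢ W
    nec▷ : W ⊢ I → W ⊢ x ▷ˢ I
    nec▶ : W ⊢ I → W ⊢ x ▶ˢ I

    conj△ : x △ˢ ((x ▲ˢ Y) ⨾ Z) ⊢ W → Y ⨾ (x △ˢ Z) ⊢ W
    conj▲ : x ▲ˢ ((x △ˢ Y) ⨾ Z) ⊢ W → Y ⨾ (x ▲ˢ Z) ⊢ W
    conj▷ : W ⊢ x ▷ˢ ((x ▶ˢ Y) ⨾ Z) → W ⊢ Y ⨾ (x ▷ˢ Z)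
    conj▶ : W ⊢ x ▶ˢ ((x ▷ˢ Y) ⨾ Z) → W ⊢ Y ⨾ (x ▶ˢ Z)

    FS△ : (x ▷ˢ Y) > (x △ˢ Z) ⊢ W → x △ˢ (Y > Z) ⊢ W
    FS▲ : (x ▶ˢ Y) > (x ▲ˢ Z) ⊢ W → x ▲ˢ (Y > Z) ⊢ W
    FS▷ : W ⊢ (x △ˢ Y) > (x ▷ˢ Z) → W ⊢ x ▷ˢ (Y > Z)
    FS▶ : W ⊢ (x ▲ˢ Y) > (x ▶ˢ Z) → W ⊢ x ▶ˢ (Y > Z)

    mon△ : (x △ˢ Y) ⨾ (x △ˢ Z) ⊢ W → x △ˢ (Y ⨾ Z) ⊢ W
    mon▲ : (x ▲ˢ Y) ⨾ (x ▲ˢ Z) ⊢ W → x ▲ˢ (Y ⨾ Z) ⊢ W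
    mon▷ : W ⊢ (x ▷ˢ Y) ⨾ (x ▷ˢ Z) → W ⊢ x ▷ˢ (Y ⨾ Z)
    mon▶ : W ⊢ (x ▶ˢ Y) ⨾ (x ▶ˢ Z) → W ⊢ x ▶ˢ (Y ⨾ Z)

    swap-outˡ : (𝐚 ▲₃ˢ F) ▲ˢ (𝐚 ▲ˢ X) ⊢ Y → 𝐚 ▲ˢ (F ▲ˢ X) ⊢ Y
    swap-outʳ : X ⊢ (𝐚 ▲₃ˢ F) ▶ˢ (𝐚 ▶ˢ Y) → X ⊢ 𝐚 ▶ˢ (F ▶ˢ Y)
    swap-inˡ  : 𝐚 ▲ˢ (F ▲ˢ X) ⊢ Y → (𝐚 ▲₃ˢ F) ▲ˢ (𝐚 ▲ˢ ((F △ˢ I) ⨾ X)) ⊢ Y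
    swap-inʳ  : X ⊢ 𝐚 ▶ˢ (F ▶ˢ Y) → X ⊢ (𝐚 ▲₃ˢ F) ▶ˢ (𝐚 ▶ˢ ((F △ˢ I) > Y))
    balance   : X ⊢ Y → F △ˢ X ⊢ F ▷ˢ Y

  _⊣⊢_ : Tm FM → Tm FM → Set (ℓp ⊔ ℓf ⊔ ℓa)
  C ⊣⊢ D = (⌜ C ⌝ ⊢ ⌜ D ⌝) × (⌜ D ⌝ ⊢ ⌜ C ⌝)

{-# OPTIONS --safe #-}

-- With cut and the identity sequents for all terms, the reductions rest on four facts.
-- Balance gives α △₀ A ⊢ α ▷₀ A (functionality); conjugation gives
-- α ▷ C ; α △ A ⊢ α △ E whenever C ; A ⊢ E (so a box is turned into a diamond by the
-- precondition α △ ⊤); Fischer Servi gives (α △₀ ⊤) ⟶ D ⊢ α ▷₀ C whenever α △₀ ⊤ ; D ⊢ α ▷₀ C;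
-- and the swap rules, read through the adjunctions △ ⊣ ▶ and ▲ ⊣ ▷, exchange α with 𝐚.

module Submission where

open import Defs
open import Level using (Level)
open import Data.Product using (_×_; _,_)

module Derivations {ℓp ℓf ℓa : Level}
  (AtProp : Set ℓp) (AtFnc : Set ℓf) (AtAg : Set ℓa) where

  open DynamicCalculus AtProp AtFnc AtAg

  private variable
    i         : Idx
    t         : Ty
    X Y Z     : Str FM
    A B C D E : Tm FM

  ⊢-refl : (a : Tm t) → ⌜ a ⌝ ⊢ ⌜ a ⌝
  ⊢-refl (prop p)  = atom here here
  ⊢-refl (fnc c)   = ax-fnc c
  ⊢-refl (agent c) = ax-ag c
  ⊢-refl (a ▲₃ α)  = ▲₃ˡ (▲₃ʳ (⊢-refl a) (⊢-refl α))
  ⊢-refl (a △₃ α)  = △₃ˡ (△₃ʳ (⊢-refl a) (⊢-refl α))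
  ⊢-refl ⊥         = ⊥ʳ ax-⊥
  ⊢-refl ⊤         = ⊤ˡ ax-⊤
  ⊢-refl (A ∧ B)   = ∧ˡ (∧ʳ (⊢-refl A) (⊢-refl B))
  ⊢-refl (A ∨ B)   = ∨ʳ (∨ˡ (⊢-refl A) (⊢-refl B))
  ⊢-refl (A ⟶ B)   = ⟶ʳ (⟶ˡ (⊢-refl A) (⊢-refl B))
  ⊢-refl (A ⟵ B)   = ⟵ʳ (⟵ˡ (⊢-refl A) (⊢-refl B))
  ⊢-refl (A ≻ B)   = ≻ˡ (≻ʳ (⊢-refl A) (⊢-refl B))
  ⊢-refl (A ≺ B)   = ≺ˡ (≺ʳ (⊢-refl A) (⊢-refl B))
  ⊢-refl (a △ A)   = △ˡ (△ʳ (⊢-refl a) (⊢-refl A))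
  ⊢-refl (a ▲ A)   = ▲ˡ (▲ʳ (⊢-refl a) (⊢-refl A))
  ⊢-refl (a ▷ A)   = ▷ʳ (▷ˡ (⊢-refl a) (⊢-refl A))
  ⊢-refl (a ▶ A)   = ▶ʳ (▶ˡ (⊢-refl a) (⊢-refl A))

  weakenˡ : X ⊢ Z → Y ⨾ X ⊢ Z
  weakenˡ p = ⨾<⁻¹ (W<ʳ p)

  weakenʳ : X ⊢ Z → X ⨾ Y ⊢ Z
  weakenʳ p = ⨾>⁻¹ (W>ʳ p)

  -- Cut replaces only a whole antecedent, so the component is first displayed by residuation.
  cut-⨾ˡ : X ⊢ ⌜ A ⌝ → ⌜ A ⌝ ⨾ Y ⊢ Z → X ⨾ Y ⊢ Z
  cut-⨾ˡ p q = ⨾<⁻¹ (cut _ p (⨾< q))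

  cut-⨾ʳ : Y ⊢ ⌜ A ⌝ → X ⨾ ⌜ A ⌝ ⊢ Z → X ⨾ Y ⊢ Z
  cut-⨾ʳ p q = ⨾>⁻¹ (cut _ p (⨾> q))

  ∧-intro : X ⊢ ⌜ A ⌝ → X ⊢ ⌜ B ⌝ → X ⊢ ⌜ A ∧ B ⌝
  ∧-intro p q = Cˡ (∧ʳ p q)

  ∨-elim : ⌜ A ⌝ ⊢ X → ⌜ B ⌝ ⊢ X → ⌜ A ∨ B ⌝ ⊢ X
  ∨-elim p q = Cʳ (∨ˡ p q)

  ⟶-intro : ⌜ A ⌝ ⨾ X ⊢ ⌜ B ⌝ → X ⊢ ⌜ A ⟶ B ⌝
  ⟶-intro p = ⟶ʳ (⨾> p)

  ⟶-elim : ⌜ A ⌝ ⨾ ⌜ A ⟶ B ⌝ ⊢ ⌜ B ⌝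
  ⟶-elim = ⨾>⁻¹ (⟶ˡ (⊢-refl _) (⊢-refl _))

  ∧-projˡ : ⌜ A ∧ B ⌝ ⊢ ⌜ A ⌝
  ∧-projˡ = ∧ˡ (weakenʳ (⊢-refl _))

  ∧-projʳ : ⌜ A ∧ B ⌝ ⊢ ⌜ B ⌝
  ∧-projʳ = ∧ˡ (weakenˡ (⊢-refl _))

  ∨-inj₁ : ⌜ A ⌝ ⊢ ⌜ A ∨ B ⌝
  ∨-inj₁ = ∨ʳ (>⨾⁻¹ (W>ˡ (⊢-refl _)))

  ∨-inj₂ : ⌜ B ⌝ ⊢ ⌜ A ∨ B ⌝
  ∨-inj₂ = ∨ʳ (<⨾⁻¹ (W<ˡ (⊢-refl _)))

  ⊤-intro : X ⊢ ⌜ ⊤ ⌝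
  ⊤-intro = IWˡ ax-⊤

  ⊥-elim : ⌜ ⊥ ⌝ ⊢ X
  ⊥-elim = IWʳ ax-⊥

  I⨾-elim : I ⨾ X ⊢ Y → X ⊢ Y
  I⨾-elim p = I<ʳ⁻¹ (⨾< p)

  △-mono : (a : Tm (act i)) → ⌜ A ⌝ ⊢ ⌜ B ⌝ → ⌜ a △ A ⌝ ⊢ ⌜ a △ B ⌝
  △-mono a p = △ˡ (△ʳ (⊢-refl a) p)

  ▷-mono : (a : Tm (act i)) → ⌜ A ⌝ ⊢ ⌜ B ⌝ → ⌜ a ▷ A ⌝ ⊢ ⌜ a ▷ B ⌝
  ▷-mono a p = ▷ʳ (▷ˡ (⊢-refl a) p)

  △-elim : {a : Tm (act i)} → ⌜ A ⌝ ⊢ ⌜ a ⌝ ▶ˢ X → ⌜ a △ A ⌝ ⊢ X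
  △-elim p = △ˡ (△▶⁻¹ p)

  ▷-intro : {a : Tm (act i)} → ⌜ a ⌝ ▲ˢ X ⊢ ⌜ A ⌝ → X ⊢ ⌜ a ▷ A ⌝
  ▷-intro p = ▷ʳ (▲▷ p)

  ▷-counit : {a : Tm (act i)} → X ⊢ ⌜ a ▷ A ⌝ → ⌜ a ⌝ ▲ˢ X ⊢ ⌜ A ⌝
  ▷-counit p = ▲▷⁻¹ (cut _ p (▷ˡ (⊢-refl _) (⊢-refl _)))

  -- Bridges the precondition as a formula and its structural form `⌜ a ⌝ △ˢ I`, which the swap-in
  -- rules produce.
  △⊤-elim : {a : Tm (act i)} → ⌜ a ⌝ △ˢ I ⊢ X → ⌜ a △ ⊤ ⌝ ⊢ X
  △⊤-elim p = △-elim (⊤ˡ (△▶ p))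

  △⇒△⊤ : (a : Tm (act i)) → ⌜ a △ A ⌝ ⊢ ⌜ a △ ⊤ ⌝
  △⇒△⊤ a = △-mono a ⊤-intro

  △-⊥ : (a : Tm (act i)) → ⌜ a △ ⊥ ⌝ ⊢ ⌜ ⊥ ⌝
  △-⊥ a = ⊥ʳ (△-elim (nec▶ ax-⊥))

  -- Across `△ ⊣ ▶` the disjunction stands alone on the left, and `mon▶` splits the succedent into
  -- the shape `∨ˡ` concludes.
  △-∨ : (a : Tm (act i)) → ⌜ a △ (A ∨ B) ⌝ ⊢ ⌜ (a △ A) ∨ (a △ B) ⌝
  △-∨ a = ∨ʳ (△-elim (mon▶ (∨ˡ (△▶ (△ʳ (⊢-refl a) (⊢-refl _)))
                                (△▶ (△ʳ (⊢-refl a) (⊢-refl _))))))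

  ▷-∧ : (a : Tm (act i)) → ⌜ a ▷ A ⌝ ⨾ ⌜ a ▷ B ⌝ ⊢ ⌜ a ▷ (A ∧ B) ⌝
  ▷-∧ a = ▷-intro (mon▲ (∧ʳ (▷-counit (⊢-refl _)) (▷-counit (⊢-refl _))))

  ▷⨾△ : {a : Tm (act i)} → X ⊢ ⌜ a ▷ C ⌝ → ⌜ C ⌝ ⨾ ⌜ A ⌝ ⊢ ⌜ E ⌝ →
        X ⨾ ⌜ a △ A ⌝ ⊢ ⌜ a △ E ⌝
  ▷⨾△ p q = ⨾>⁻¹ (△ˡ (⨾> (conj△ (△ʳ (⊢-refl _) (cut-⨾ˡ (▷-counit p) q)))))

  △⊤⨾▷ : {a : Tm (act i)} → X ⊢ ⌜ a ▷ C ⌝ → ⌜ a △ ⊤ ⌝ ⨾ X ⊢ ⌜ a △ C ⌝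
  △⊤⨾▷ p = Eˡ (▷⨾△ p (weakenʳ (⊢-refl _)))

  △⨾▷⟶ : (a : Tm (act i)) → ⌜ a △ A ⌝ ⨾ ⌜ a ▷ (A ⟶ B) ⌝ ⊢ ⌜ a △ B ⌝
  △⨾▷⟶ a = Eˡ (▷⨾△ (⊢-refl _) (Eˡ ⟶-elim))

  -- `FS▷` yields the succedent `⌜ a ⌝ ▷ˢ (⌜ A ⌝ > ⌜ B ⌝)`. The box is residuated away so that `⟶ʳ`
  -- meets a bare succedent, and `▷-intro` restores it.
  △⟶▷-elim : (a : Tm (act i)) → ⌜ (a △ A) ⟶ (a ▷ B) ⌝ ⊢ ⌜ a ▷ (A ⟶ B) ⌝
  △⟶▷-elim a = ▷-intro (⟶ʳ (▲▷⁻¹ (FS▷ (⟶ˡ (△ʳ (⊢-refl a) (⊢-refl _))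
                                            (▷ˡ (⊢-refl a) (⊢-refl _))))))

  -- `A` serves twice, for modus ponens and for `p`, so it is duplicated as `A ∧ A` and split again.
  ⟶-chain : ⌜ A ⌝ ⨾ ⌜ D ⌝ ⊢ ⌜ E ⌝ → ⌜ A ⟶ D ⌝ ⊢ ⌜ A ⟶ E ⌝
  ⟶-chain p = ⟶-intro (cut-⨾ˡ (∧-intro (⊢-refl _) (⊢-refl _))
                (⨾<⁻¹ (∧ˡ (⨾< (Aˡ (cut-⨾ʳ ⟶-elim p))))))

  -- `△⟶▷-elim` at `⊤` gives `a ▷ (⊤ ⟶ C)`; the trivial antecedent is then discharged under the box.
  △⊤⟶-elim : (a : Tm (act i)) → ⌜ a △ ⊤ ⌝ ⨾ ⌜ D ⌝ ⊢ ⌜ a ▷ C ⌝ →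
             ⌜ (a △ ⊤) ⟶ D ⌝ ⊢ ⌜ a ▷ C ⌝
  △⊤⟶-elim a p = cut _ (⟶-chain p) (cut _ (△⟶▷-elim a) (▷-mono a ⊤⟶-elim))
    where
    ⊤⟶-elim : ⌜ ⊤ ⟶ A ⌝ ⊢ ⌜ A ⌝
    ⊤⟶-elim = I⨾-elim (cut-⨾ˡ ax-⊤ ⟶-elim)

  △⇒▷ : (α : Tm FNC) → ⌜ A ⌝ ⊢ ⌜ B ⌝ → ⌜ α △ A ⌝ ⊢ ⌜ α ▷ B ⌝
  △⇒▷ α p = △ˡ (▷ʳ (balance p))

  module _ (a : Tm AG) (α : Tm FNC) where

    △-swap : ⌜ α △ (a △ A) ⌝ ⊢ ⌜ a △ ((a ▲₃ α) △ A) ⌝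
    △-swap = △-elim (△-elim (swap-outʳ (△▶ (△▶
      (△ʳ (⊢-refl a) (△ʳ (▲₃ʳ (⊢-refl a) (⊢-refl α)) (⊢-refl _)))))))

    -- The precondition comes from the `(F △ˢ I) > Y` left by `swap-inʳ`. The adjoint `◀ˢ` isolates
    -- `a ▲₃ α` on the left, where `▲₃ˡ` can open it.
    △-swap⁻¹ : ⌜ α △ ⊤ ⌝ ⨾ ⌜ a △ ((a ▲₃ α) △ A) ⌝ ⊢ ⌜ α △ (a △ A) ⌝
    △-swap⁻¹ = ⨾<⁻¹ (△⊤-elim (⨾< (⨾>⁻¹ (△-elim (△ˡ (△◀⁻¹ (▲₃ˡ (△◀ (△▶⁻¹
      (swap-inʳ (△▶ (△▶ (△ʳ (⊢-refl α) (△ʳ (⊢-refl a) (⊢-refl _)))))))))))))))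

    -- Dual use of `swap-inˡ`: here the precondition appears in the antecedent, and `◁ˢ` isolates
    -- `a ▲₃ α`.
    ▷-swap : ⌜ α △ ⊤ ⌝ ⨾ ⌜ α ▷ (a ▷ A) ⌝ ⊢ ⌜ a ▷ ((a ▲₃ α) ▷ A) ⌝
    ▷-swap = ⨾<⁻¹ (△⊤-elim (⨾< (▷-intro (▷-intro (▲◁⁻¹ (▲₃ˡ (▲◁
      (swap-inˡ (▷-counit (▷-counit (⊢-refl _)))))))))))

    ▷-swap⁻¹ : ⌜ a ▷ ((a ▲₃ α) ▷ A) ⌝ ⊢ ⌜ α ▷ (a ▷ A) ⌝
    ▷-swap⁻¹ = ▷-intro (▷-intro (swap-outˡ (▲▷⁻¹ (▲▷⁻¹
      (▷ˡ (⊢-refl a) (▷ˡ (▲₃ʳ (⊢-refl a) (⊢-refl α)) (⊢-refl _)))))))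

mainTheorem3 : {ℓp ℓf ℓa : Level} (AtProp : Set ℓp) (AtFnc : Set ℓf) (AtAg : Set ℓa) →
    let open DynamicCalculus AtProp AtFnc AtAg in
    (at : AtProp) (α : Tm FNC) (a : Tm AG) (A B : Tm FM) →
    let p = prop at in
    (α △₀ p ⊣⊢ (α △₀ ⊤) ∧ p)
    × (α ▷₀ p ⊣⊢ (α △₀ ⊤) ⟶ p)
    × (α △₀ ⊥ ⊣⊢ ⊥)
    × (α △₀ ⊤ ⊣⊢ α △₀ ⊤)
    × (α ▷₀ ⊤ ⊣⊢ ⊤)
    × (α ▷₀ ⊥ ⊣⊢ (α △₀ ⊤) ⟶ ⊥)
    × (α ▷₀ (A ∧ B) ⊣⊢ (α ▷₀ A) ∧ (α ▷₀ B))
    × (α △₀ (A ∧ B) ⊣⊢ (α △₀ A) ∧ (α △₀ B))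
    × (α △₀ (A ∨ B) ⊣⊢ (α △₀ A) ∨ (α △₀ B))
    × (α ▷₀ (A ∨ B) ⊣⊢ (α △₀ ⊤) ⟶ ((α △₀ A) ∨ (α △₀ B)))
    × (α △₀ (A ⟶ B) ⊣⊢ (α △₀ ⊤) ∧ ((α △₀ A) ⟶ (α △₀ B)))
    × (α ▷₀ (A ⟶ B) ⊣⊢ (α △₀ A) ⟶ (α △₀ B))
    × (α △₀ (a △₂ A) ⊣⊢ (α △₀ ⊤) ∧ (a △₂ ((a ▲₃ α) △₁ A)))
    × (α ▷₀ (a △₂ A) ⊣⊢ (α △₀ ⊤) ⟶ (a △₂ ((a ▲₃ α) △₁ A)))
    × (α ▷₀ (a ▷₂ A) ⊣⊢ (α △₀ ⊤) ⟶ (a ▷₂ ((a ▲₃ α) ▷₁ A)))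
    × (α △₀ (a ▷₂ A) ⊣⊢ (α △₀ ⊤) ∧ (a ▷₂ ((a ▲₃ α) ▷₁ A)))
mainTheorem3 AtProp AtFnc AtAg at α a A B =
    ( ∧-intro (△⇒△⊤ α) p△
    , ∧ˡ (△⊤⨾▷ p▷) )
  , ( ⟶-intro (cut _ (△⊤⨾▷ (⊢-refl _)) p△)
    , △⊤⟶-elim α (weakenˡ p▷) )
  , (△-⊥ α , ⊥-elim)
  , (⊢-refl _ , ⊢-refl _)
  , (⊤-intro , ▷-intro ⊤-intro)
  , ( ⟶-intro (cut _ (△⊤⨾▷ (⊢-refl _)) (△-⊥ α))
    , △⊤⟶-elim α (weakenˡ ⊥-elim) )
  , ( ∧-intro (▷-mono α ∧-projˡ) (▷-mono α ∧-projʳ)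
    , ∧ˡ (▷-∧ α) )
  , ( ∧-intro (△-mono α ∧-projˡ) (△-mono α ∧-projʳ)
    -- Functionality turns the first diamond into a box, which conjugation then carries into the
    -- second.
    , ∧ˡ (▷⨾△ (△⇒▷ α (⊢-refl _)) (∧ʳ (⊢-refl _) (⊢-refl _))) )
  , ( △-∨ α
    , ∨-elim (△-mono α ∨-inj₁) (△-mono α ∨-inj₂) )
  , ( ⟶-intro (cut _ (△⊤⨾▷ (⊢-refl _)) (△-∨ α))
    , △⊤⟶-elim α (weakenˡ (∨-elim (△⇒▷ α ∨-inj₁) (△⇒▷ α ∨-inj₂))) )
  , ( ∧-intro (△⇒△⊤ α) (cut _ (△⇒▷ α (⊢-refl _)) ▷⟶)
    , ∧ˡ (△⊤⨾▷ ▷⟶⁻¹) )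
  , (▷⟶ , ▷⟶⁻¹)
  , ( ∧-intro (△⇒△⊤ α) (△-swap a α)
    , ∧ˡ (△-swap⁻¹ a α) )
  , ( ⟶-intro (cut _ (△⊤⨾▷ (⊢-refl _)) (△-swap a α))
    , △⊤⟶-elim α (cut _ (△-swap⁻¹ a α) (△⇒▷ α (⊢-refl _))) )
  , ( ⟶-intro (▷-swap a α)
    , △⊤⟶-elim α (weakenˡ (▷-swap⁻¹ a α)) )
  -- Contraction lets the one diamond supply both the precondition and, by functionality, the box
  -- that `▷-swap` consumes.
  , ( ∧-intro (△⇒△⊤ α) (Cˡ (cut-⨾ˡ (△⇒△⊤ α) (cut-⨾ʳ (△⇒▷ α (⊢-refl _)) (▷-swap a α))))
    , ∧ˡ (△⊤⨾▷ (▷-swap⁻¹ a α)) )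
  where
  open DynamicCalculus AtProp AtFnc AtAg
  open Derivations AtProp AtFnc AtAg

  -- Epistemic actions do not change facts: the atom axiom absorbs functional actions on either side
  -- of an atom.
  p△ : ⌜ α △ prop at ⌝ ⊢ ⌜ prop at ⌝
  p△ = △ˡ (atom (△-at _ here) here)

  p▷ : ⌜ prop at ⌝ ⊢ ⌜ α ▷ prop at ⌝
  p▷ = ▷ʳ (atom here (▷-at _ here))

  ▷⟶ : ⌜ α ▷ (A ⟶ B) ⌝ ⊢ ⌜ (α △ A) ⟶ (α △ B) ⌝
  ▷⟶ = ⟶-intro (△⨾▷⟶ α)

  -- Functionality relaxes the consequent `α △ B` to `α ▷ B`, the form Fischer Servi accepts.
  ▷⟶⁻¹ : ⌜ (α △ A) ⟶ (α △ B) ⌝ ⊢ ⌜ α ▷ (A ⟶ B) ⌝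
  ▷⟶⁻¹ = cut _ (⟶-chain (weakenˡ (△⇒▷ α (⊢-refl _)))) (△⟶▷-elim α)
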